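{- Let $(W,S)$ be a finite Coxeter system, let $w\in W$ with a fixed reduced expression $w=s_1\cdots s_k$, and let $\mathcal{C}^\downarrow$ and $\phi:\mathcal{C}^\downarrow\to[e,w]$, $\phi(C)=p(C)w$, be as in the context. Then $\phi$ is injective.
   Context: $(W,S)$ is a finite Coxeter system, realized as a finite reflection group acting on a real vector space $V$ in a natural geometric representation (each $s\in S$ acts as a reflection and no nonzero vector is fixed by all of $W$). $T=\{usu^{ -1}: s\in S,u\in W\}$; each $t\in T$ is the reflection through a hyperplane. Bruhat order: $u\le w$ iff some reduced expression for $w$ contains a subword expressing $u$; $[e,w]=\{u: u\le w\}$. Put $t_i=s_1\cdots s_{i-1}s_is_{i-1}\cdots s_1$ and let $H_i$ be its reflecting hyperplane; $\mathcal{A}_w=\{H_1,\dots,H_k\}$ with total order $H_1>\cdots>H_k$. $L_w$ is the set of intersections of subsets of $\mathcal{A}_w$ ($\hat0=V$), ordered by reverse inclusion, covering relation $\lhd$. $\lambda(A\lhd B)=\min\{H\in\mathcal{A}_w: H\supseteq B, H\not\supseteq A\}$. A saturated chain $\hat0=X_0\lhd\cdots\lhd X_m$ is $\lambda$-decreasing if $\lambda(X_{i-1}\lhd X_i)>\lambda(X_i\lhd X_{i+1})$ for all $i\in[m-1]$; $\mathcal{C}^\downarrow$ is the set of such chains (including $\{\hat0\}$). If $\lambda(X_{i-1}\lhd X_i)=H_{j_i}$ then $p(C)=t_{j_1}\cdots t_{j_m}$. It is known that $p(C)w\le w$ for $C\in\mathcal{C}^\downarrow$, so $\phi(C)=p(C)w$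 maps $\mathcal{C}^\downarrow$ into $[e,w]$. -}

module Defs where

open import Level using (0ℓ)
open import Data.Nat using (ℕ; zero; suc; _<_; _≤_)
open import Data.Fin using (Fin; toℕ)
open import Data.Fin.Subset using (Subset; _∈_; ⊥)
open import Data.List using (List; []; _∷_; take; length; lookup; foldr)
open import Data.List.Relation.Unary.Any using (Any)
open import Data.List.Relation.Binary.Pointwise using (Pointwise)
open import Data.Product using (Σ; ∃; _×_; _,_; proj₁; proj₂)
open import Data.Unit using (⊤)
open import Data.Maybe using (Maybe; just; nothing)
open import Relation.Binary.PropositionalEquality using (_≡_)
open import Relation.Nullary using (¬_)
open import Relation.Binary.Structures using (IsTotalOrder)
open import Algebra.Structures using (IsCommutativeRing)
open import Algebra.Bundles using (Group)

-- An ordered field (abstract stand-in for ℝ), equality is ≡.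

record OrderedField : Set₁ where
  infixl 6 _+_
  infixl 7 _*_
  infix 4 _≤F_
  field
    Carrier : Set
    _+_ _*_ : Carrier → Carrier → Carrier
    -_      : Carrier → Carrier
    0# 1#   : Carrier
    isCommutativeRing : IsCommutativeRing _≡_ _+_ _*_ -_ 0# 1#
    0≢1     : ¬ (0# ≡ 1#)
    inverse : ∀ x → ¬ (x ≡ 0#) → ∃ λ y → x * y ≡ 1#
    _≤F_    : Carrier → Carrier → Set
    isTotalOrder : IsTotalOrder _≡_ _≤F_
    +-mono  : ∀ x y z → x ≤F y → x + z ≤F y + z
    *-nonneg : ∀ x y → 0# ≤F x → 0# ≤F y → 0# ≤F x * y

module Vectors (K : OrderedField) (n : ℕ) where
  open OrderedField K

  V : Set
  V = Fin n → Carrier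

  infix 4 _≈V_
  _≈V_ : V → V → Set
  u ≈V v = ∀ i → u i ≡ v i

  _+V_ : V → V → V
  (u +V v) i = u i + v i

  _·V_ : Carrier → V → V
  (c ·V v) i = c * v i

  0V : V
  0V i = 0#

  sumF : ∀ {m} → (Fin m → Carrier) → Carrier
  sumF {zero}  f = 0#
  sumF {suc m} f = f Fin.zero + sumF (λ i → f (Fin.suc i))

  dot : V → V → Carrier
  dot c v = sumF (λ i → c i * v i)

  IsLinear : (V → V) → Set
  IsLinear g = (∀ u v → g (u +V v) ≈V (g u +V g v))
             × (∀ c v → g (c ·V v) ≈V (c ·V g v))

  IsReflection : (V → V) → Set
  IsReflection g = IsLinear g
                 × (∀ v → g (g v) ≈V v)
                 × Σ V (λ c → ¬ (c ≈V 0V)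
                         × (∀ v → (g v ≈V v → dot c v ≡ 0#)
                                × (dot c v ≡ 0# → g v ≈V v)))

module GroupStuff (G : Group 0ℓ 0ℓ) where
  open Group G

  pow : Carrier → ℕ → Carrier
  pow x zero    = ε
  pow x (suc m) = x ∙ pow x m

  wordProd : ∀ {r} → (Fin r → Carrier) → List (Fin r) → Carrier
  wordProd s = foldr (λ a x → s a ∙ x) ε

IsHom : (G H : Group 0ℓ 0ℓ) → (Group.Carrier G → Group.Carrier H) → Set
IsHom G H h = (∀ {x y} → Group._≈_ G x y → Group._≈_ H (h x) (h y))
            × (∀ x y → Group._≈_ H (h (Group._∙_ G x y)) (Group._∙_ H (h x) (h y)))

-- (W,S) is a Coxeter system, S indexed by Fin r (distinct elements):
-- the s i are distinct involutions generating W, and W has the presentation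
-- ⟨ S | (s t)^{m(s,t)} = 1 ⟩ : every assignment of S into a group satisfying
-- the same relations extends to a homomorphism.
record IsCoxeterSystem (W : Group 0ℓ 0ℓ) {r : ℕ} (s : Fin r → Group.Carrier W) : Set₁ where
  open Group W
  open GroupStuff W
  field
    distinct   : ∀ i j → s i ≈ s j → i ≡ j
    nontrivial : ∀ i → ¬ (s i ≈ ε)
    involution : ∀ i → (s i ∙ s i) ≈ ε
    generates  : ∀ x → Σ (List (Fin r)) (λ a → wordProd s a ≈ x)
    presentation :
      (H : Group 0ℓ 0ℓ) (f : Fin r → Group.Carrier H) →
      (∀ i j m → pow (s i ∙ s j) m ≈ ε →
         Group._≈_ H (GroupStuff.pow H (Group._∙_ H (f i) (f j)) m) (Group.ε H)) →
      Σ (Carrier → Group.Carrier H) (λ h → IsHom W H h × (∀ i → Group._≈_ H (h (s i)) (f i)))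

record FiniteReflectionCoxeterSystem (K : OrderedField) (n r : ℕ) : Set₁ where
  open Vectors K n
  field
    W   : Group 0ℓ 0ℓ
  open Group W
  field
    s   : Fin r → Carrier
    coxeter : IsCoxeterSystem W s
    finite  : Σ (List Carrier) (λ xs → ∀ x → Any (x ≈_) xs)
    ρ       : Carrier → V → V
    ρ-linear : ∀ x → IsLinear (ρ x)
    ρ-resp  : ∀ {x y} → x ≈ y → ∀ v → ρ x v ≈V ρ y v
    ρ-hom   : ∀ x y v → ρ (x ∙ y) v ≈V ρ x (ρ y v)
    ρ-ε     : ∀ v → ρ ε v ≈V v
    faithful : ∀ x y → (∀ v → ρ x v ≈V ρ y v) → x ≈ y
    reflections : ∀ i → IsReflection (ρ (s i))
    essential : ∀ v → (∀ x → ρ x v ≈V v) → v ≈V 0V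

module Arrangement {K : OrderedField} {n r : ℕ}
                   (Σ' : FiniteReflectionCoxeterSystem K n r)
                   (word : List (Fin r)) where
  open Vectors K n
  open FiniteReflectionCoxeterSystem Σ'
  open Group W
  open GroupStuff W

  k : ℕ
  k = length word

  w : Carrier
  w = wordProd s word

  IsReduced : Set
  IsReduced = ∀ (b : List (Fin r)) → wordProd s b ≈ w → k ≤ length b

  -- t_i = s_1 ⋯ s_{i-1} s_i s_{i-1} ⋯ s_1  (positions i are 0-based Fin k)
  t : Fin k → Carrier
  t i = (u ∙ s (lookup word i)) ∙ u ⁻¹
    where u = wordProd s (take (toℕ i) word)

  H : Fin k → V → Set
  H i v = ρ (t i) v ≈V v

  -- the intersection of the hyperplanes indexed by a subset X ⊆ A_w
  -- (the empty subset gives 0̂ = V)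
  Flat : Subset k → V → Set
  Flat X v = ∀ j → j ∈ X → H j v

  _≤L_ : Subset k → Subset k → Set
  A ≤L B = ∀ v → Flat B v → Flat A v

  _≈L_ : Subset k → Subset k → Set
  A ≈L B = A ≤L B × B ≤L A

  _<L_ : Subset k → Subset k → Set
  A <L B = A ≤L B × ¬ (B ≤L A)

  _⋖_ : Subset k → Subset k → Set
  A ⋖ B = A <L B × (∀ C → ¬ (A <L C × C <L B))

  _⊇H_ : Fin k → Subset k → Set
  j ⊇H B = ∀ v → Flat B v → H j v

  -- λ(A ⋖ B) = H_j : H_j is the minimum, in the order H_1 > ⋯ > H_k,
  -- of the hyperplanes containing B but not A; i.e. j is the largest such index
  Label : Subset k → Subset k → Fin k → Set
  Label A B j = (j ⊇H B) × ¬ (j ⊇H A)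
              × (∀ i → i ⊇H B → ¬ (i ⊇H A) → toℕ i ≤ toℕ j)

  -- λ-decreasing saturated chains starting at the flat A.
  -- A chain is the list of flats X_1, …, X_m after A, paired with labels
  -- j_1, …, j_m with λ(X_{i-1} ⋖ X_i) = H_{j_i}; decreasing in the order
  -- H_1 > ⋯ > H_k means the indices strictly increase.
  data DecChain : Subset k → Maybe (Fin k) → List (Subset k × Fin k) → Set where
    done : ∀ {A prev} → DecChain A prev []
    step : ∀ {A prev X j rest} →
           A ⋖ X → Label A X j →
           (∀ p → prev ≡ just p → toℕ p < toℕ j) →
           DecChain X (just j) rest →
           DecChain A prev ((X , j) ∷ rest)

  IsDecChain : List (Subset k × Fin k) → Set
  IsDecChain C = DecChain ⊥ nothing C

  p : List (Subset k × Fin k) → Carrier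
  p = foldr (λ Xj x → t (proj₂ Xj) ∙ x) ε

  φ : List (Subset k × Fin k) → Carrier
  φ C = p C ∙ w

  SameChain : List (Subset k × Fin k) → List (Subset k × Fin k) → Set
  SameChain = Pointwise (λ a b → proj₁ a ≈L proj₁ b)

{-# OPTIONS --safe #-}

-- Reversing a chain puts its last flat X_m first.  Averaging the dot product over W
-- gives a W-invariant positive definite form, and with it Carter's lemma: the vectors
-- fixed by p(C) = t_{j_1} ⋯ t_{j_m} are exactly those of X_m.  So p(C) determines X_m.
-- Since the labels of C are decreasing, the last label j_m is the largest index of a
-- hyperplane containing X_m, so it is determined too; cancelling t_{j_m} and
-- inducting recovers the whole chain.
module Submission where

open import Defs
open import Level using (0ℓ)
open import Data.Nat using (ℕ; zero; suc; _<_; _≤_)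
import Data.Nat.Properties as ℕₚ
open import Data.Fin using (Fin; zero; suc; toℕ)
open import Data.Fin.Properties using (toℕ-injective)
open import Data.Fin.Subset using (Subset; _∪_; ⁅_⁆) renaming (⊥ to ∅)
open import Data.Fin.Subset.Properties using (∉⊥; x∈p∪q⁻; x∈p∪q⁺; x∈⁅x⁆; x∈⁅y⁆⇒x≡y)
open import Data.List using (List; []; _∷_; _++_; map; foldr; lookup; reverse; _ʳ++_)
open import Data.List.Properties using (reverse-involutive)
import Data.List.Membership.Setoid as Membership
import Data.List.Membership.Setoid.Properties as Membershipₚ
import Data.List.Relation.Binary.Permutation.Setoid as Permutation
import Data.List.Relation.Binary.Permutation.Setoid.Properties as Permutationₚ
open import Data.List.Relation.Binary.Pointwise as Pointwise using ([]; _∷_)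
open import Data.List.Relation.Unary.All using ([]; _∷_)
open import Data.List.Relation.Unary.All.Properties using (All¬⇒¬Any; ¬Any⇒All¬)
open import Data.List.Relation.Unary.AllPairs using ([]; _∷_)
open import Data.List.Relation.Unary.Any using (Any; here; there)
import Data.List.Relation.Unary.Unique.Setoid as Uniqueness
import Data.List.Relation.Unary.Unique.Setoid.Properties as Uniquenessₚ
open import Data.Maybe using (Maybe; just; nothing)
open import Data.Product using (Σ; ∃; _×_; _,_; proj₁; proj₂)
open import Data.Sum using (inj₁; inj₂)
open import Function using (_∘_; _$_)
open import Relation.Binary.Bundles using (Setoid)
open import Relation.Binary.PropositionalEquality
  using (_≡_; refl; sym; trans; cong; cong₂; subst; subst₂; module ≡-Reasoning)
open import Relation.Binary.Structures using (IsTotalOrder)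
import Relation.Binary.Reasoning.Setoid as SetoidReasoning
open import Relation.Nullary using (¬_; Dec; yes; no)
open import Relation.Nullary.Decidable using (decidable-stable; ¬¬-excluded-middle)
open import Relation.Nullary.Negation using (contradiction)
open import Algebra.Bundles using (Group; CommutativeRing)
import Algebra.Properties.CommutativeSemigroup as CommutativeSemigroupₚ
import Algebra.Properties.Group as Groupₚ
import Algebra.Properties.Ring as Ringₚ

-- Duplicate-free lists up to permutation, over a setoid.

module _ (S : Setoid 0ℓ 0ℓ) where
  open Setoid S using (_≈_) renaming (Carrier to A; refl to ≈-refl; sym to ≈-sym; trans to ≈-trans)
  open Membership S using (_∈_)
  open Uniqueness S using (Unique)
  open Permutation S using (_↭_; ↭-refl; ↭-sym; ↭-trans; ↭-prep; ↭-reflexive-≋)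
  open Permutationₚ S using (shift; ∈-resp-↭; Unique-resp-↭)

  -- Find the head `x` inside `ys`, move it to the front, and recurse on the remainders. Uniqueness
  -- keeps `x` out of both remainders, so they again have the same members. It will show that right
  -- translation only rearranges a list of the group.
  unique-⊆⇒↭ : ∀ {xs ys} → Unique xs → Unique ys →
    (∀ {z} → z ∈ xs → z ∈ ys) → (∀ {z} → z ∈ ys → z ∈ xs) → ys ↭ xs
  unique-⊆⇒↭ {[]} {[]} _ _ _ _ = ↭-refl
  unique-⊆⇒↭ {[]} {y ∷ ys} _ _ _ ys⊆ = contradiction (ys⊆ (here ≈-refl)) λ ()
  unique-⊆⇒↭ {x ∷ xs} {ys} (x∉xs ∷ xs!) ys! xs⊆ ys⊆
    with as , bs , w , x≈w , ys≋ ← Membershipₚ.∈-∃++ S (xs⊆ (here ≈-refl))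
    = ↭-trans ys↭ (↭-prep x (unique-⊆⇒↭ xs! rest! to from))
    where
    ys↭ : ys ↭ x ∷ as ++ bs
    ys↭ = ↭-trans (↭-reflexive-≋ ys≋) (shift (≈-sym x≈w) as bs)
    ys!′ : Unique (x ∷ as ++ bs)
    ys!′ = Unique-resp-↭ ys↭ ys!
    rest! : Unique (as ++ bs)
    rest! with _ ∷ q ← ys!′ = q
    x∉rest : ¬ x ∈ as ++ bs
    x∉rest with q ∷ _ ← ys!′ = All¬⇒¬Any q
    to : ∀ {z} → z ∈ xs → z ∈ as ++ bs
    to z∈ with ∈-resp-↭ ys↭ (xs⊆ (there z∈))
    ... | here z≈x = contradiction (Membershipₚ.∈-resp-≈ S z≈x z∈) (All¬⇒¬Any x∉xs)
    ... | there q  = q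
    from : ∀ {z} → z ∈ as ++ bs → z ∈ xs
    from z∈ with ys⊆ (∈-resp-↭ (↭-sym ys↭) (there z∈))
    ... | here z≈x = contradiction (Membershipₚ.∈-resp-≈ S z≈x z∈) x∉rest
    ... | there q  = q

  -- ≈ need not be decidable, so duplicates can only be removed up to ¬¬.
  ¬¬unique : ∀ xs → ¬ ¬ Σ (List A) λ ys → Unique ys × (∀ {z} → z ∈ xs → z ∈ ys)
  ¬¬unique [] k = k ([] , [] , λ z∈ → z∈)
  ¬¬unique (x ∷ xs) k = ¬¬unique xs λ { (ys , ys! , xs⊆) → ¬¬-excluded-middle λ
    { (yes x∈) → k (ys , ys! , λ
        { (here z≈x) → Membershipₚ.∈-resp-≈ S (≈-sym z≈x) x∈ ; (there z∈) → xs⊆ z∈ })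
    ; (no x∉) → k (x ∷ ys , ¬Any⇒All¬ ys x∉ ∷ ys! , λ
        { (here z≈x) → here z≈x ; (there z∈) → there (xs⊆ z∈) }) } }

-- Arithmetic in an ordered field.

module OrderedFieldProperties (K : OrderedField) where
  open OrderedField K
  open IsTotalOrder isTotalOrder using (total; antisym) renaming (trans to ≤-trans)

  commutativeRing : CommutativeRing 0ℓ 0ℓ
  commutativeRing = record { isCommutativeRing = isCommutativeRing }

  open CommutativeRing commutativeRing public using
    ( +-comm; +-identityˡ; +-identityʳ; -‿inverseʳ
    ; *-assoc; *-comm; *-identityˡ; *-identityʳ; distribˡ; distribʳ; zeroˡ; zeroʳ )
  open Ringₚ (CommutativeRing.ring commutativeRing) public using
    (-1*x≈-x; -‿distribˡ-*; -‿distribʳ-*; -‿involutive; ⁻¹-anti-homo-//; x∙y⁻¹≈ε⇒x≈y)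
  open CommutativeSemigroupₚ
    (CommutativeRing.+-commutativeSemigroup commutativeRing) public using (interchange)

  -- total x y and total y x choose the same side exactly when x ≡ y.
  infix 4 _≟_
  _≟_ : ∀ x y → Dec (x ≡ y)
  x ≟ y with total x y in p | total y x in q
  ... | inj₁ x≤y | inj₁ y≤x = yes (antisym x≤y y≤x)
  ... | inj₂ y≤x | inj₂ x≤y = yes (antisym x≤y y≤x)
  ... | inj₁ _   | inj₂ _   = no λ { refl → contradiction (trans (sym p) q) λ () }
  ... | inj₂ _   | inj₁ _   = no λ { refl → contradiction (trans (sym p) q) λ () }

  x≢0∧xy≡0⇒y≡0 : ∀ {x y} → ¬ x ≡ 0# → x * y ≡ 0# → y ≡ 0#
  x≢0∧xy≡0⇒y≡0 {x} {y} x≢0 xy≡0 with x⁻¹ , xx⁻¹≡1 ← inverse x x≢0 = begin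
    y              ≡⟨ *-identityˡ y ⟨
    1# * y         ≡⟨ cong (_* y) (trans (*-comm x⁻¹ x) xx⁻¹≡1) ⟨
    x⁻¹ * x * y    ≡⟨ *-assoc x⁻¹ x y ⟩
    x⁻¹ * (x * y)  ≡⟨ cong (x⁻¹ *_) xy≡0 ⟩
    x⁻¹ * 0#       ≡⟨ zeroʳ x⁻¹ ⟩
    0#             ∎
    where open ≡-Reasoning

  x*x≡0⇒x≡0 : ∀ {x} → x * x ≡ 0# → x ≡ 0#
  x*x≡0⇒x≡0 {x} xx≡0 with x ≟ 0#
  ... | yes x≡0 = x≡0
  ... | no x≢0  = x≢0∧xy≡0⇒y≡0 x≢0 xx≡0

  0≤x⇒y≤x+y : ∀ {x} y → 0# ≤F x → y ≤F x + y
  0≤x⇒y≤x+y {x} y 0≤x = subst (_≤F x + y) (+-identityˡ y) (+-mono 0# x y 0≤x)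

  +-nonneg : ∀ {x y} → 0# ≤F x → 0# ≤F y → 0# ≤F x + y
  +-nonneg 0≤x 0≤y = ≤-trans 0≤y (0≤x⇒y≤x+y _ 0≤x)

  x+y≡0⇒y≡0 : ∀ {x y} → 0# ≤F x → 0# ≤F y → x + y ≡ 0# → y ≡ 0#
  x+y≡0⇒y≡0 {y = y} 0≤x 0≤y x+y≡0 = antisym (subst (y ≤F_) x+y≡0 (0≤x⇒y≤x+y y 0≤x)) 0≤y

  x+y≡0⇒x≡0 : ∀ {x y} → 0# ≤F x → 0# ≤F y → x + y ≡ 0# → x ≡ 0#
  x+y≡0⇒x≡0 0≤x 0≤y x+y≡0 = x+y≡0⇒y≡0 0≤y 0≤x (trans (+-comm _ _) x+y≡0)

  x≤0⇒0≤-x : ∀ {x} → x ≤F 0# → 0# ≤F - x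
  x≤0⇒0≤-x {x} x≤0 = subst₂ _≤F_ (-‿inverseʳ x) (+-identityˡ (- x)) (+-mono _ _ (- x) x≤0)

  0≤x*x : ∀ x → 0# ≤F x * x
  0≤x*x x with total 0# x
  ... | inj₁ 0≤x = *-nonneg x x 0≤x 0≤x
  ... | inj₂ x≤0 = subst (0# ≤F_) -x*-x≡x*x (*-nonneg _ _ (x≤0⇒0≤-x x≤0) (x≤0⇒0≤-x x≤0))
    where
    -x*-x≡x*x : - x * - x ≡ x * x
    -x*-x≡x*x = trans (sym (-‿distribˡ-* x (- x)))
      (trans (cong -_ (sym (-‿distribʳ-* x x))) (-‿involutive (x * x)))

  -- The order excludes characteristic two: `x` and `- x` would have the same sign, while their sum
  -- is zero.
  x≡-x⇒x≡0 : ∀ {x} → x ≡ - x → x ≡ 0#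
  x≡-x⇒x≡0 {x} x≡-x with total 0# x
  ... | inj₁ 0≤x = x+y≡0⇒x≡0 0≤x 0≤x (trans (cong (x +_) x≡-x) (-‿inverseʳ x))
  ... | inj₂ x≤0 = antisym x≤0 (subst (0# ≤F_) (sym x≡-x) (x≤0⇒0≤-x x≤0))

-- Symmetric bilinear forms on coordinate space.

module Forms (K : OrderedField) (n : ℕ) where
  open OrderedField K
  open OrderedFieldProperties K
  open Vectors K n

  infixl 6 _-V_
  _-V_ : V → V → V
  u -V v = u +V ((- 1#) ·V v)

  -V-entry : ∀ u v i → (u -V v) i ≡ u i + - v i
  -V-entry u v i = cong (u i +_) (-1*x≈-x (v i))

  u≈v⇒u-v≈0 : ∀ {u v} → u ≈V v → (u -V v) ≈V 0V
  u≈v⇒u-v≈0 {u} {v} u≈v i =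
    trans (-V-entry u v i) (trans (cong (λ a → u i + - a) (sym (u≈v i))) (-‿inverseʳ (u i)))

  u-v≈0⇒u≈v : ∀ {u v} → (u -V v) ≈V 0V → u ≈V v
  u-v≈0⇒u≈v {u} {v} u-v≈0 i = x∙y⁻¹≈ε⇒x≈y _ _ (trans (sym (-V-entry u v i)) (u-v≈0 i))

  -- Scalar equality is decidable, so vector equations may be proved by contradiction. This is what
  -- makes double-negated existence statements usable later.
  ≈V-stable : ∀ {u v} → ¬ ¬ (u ≈V v) → u ≈V v
  ≈V-stable {u} {v} ¬¬u≈v i = decidable-stable (u i ≟ v i) λ u≢v → ¬¬u≈v λ u≈v → u≢v (u≈v i)

  -- Only semidefinite, so that single coordinate products qualify and sums of forms are again
  -- forms; definiteness is proved separately.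
  record IsForm (B : V → V → Carrier) : Set where
    field
      respˡ   : ∀ {u v} z → u ≈V v → B u z ≡ B v z
      B-comm  : ∀ u v → B u v ≡ B v u
      homo-+  : ∀ u v z → B (u +V v) z ≡ B u z + B v z
      homo-·  : ∀ c v z → B (c ·V v) z ≡ c * B v z
      nonneg  : ∀ v → 0# ≤F B v v

    respʳ : ∀ {u v} z → u ≈V v → B z u ≡ B z v
    respʳ {u} {v} z u≈v = trans (B-comm z u) (trans (respˡ z u≈v) (B-comm v z))

    homo-- : ∀ u v z → B (u -V v) z ≡ B u z + - B v z
    homo-- u v z = trans (homo-+ u _ z) (cong (B u z +_) (trans (homo-· _ v z) (-1*x≈-x _)))

  coordinate-isForm : ∀ i → IsForm (λ u v → u i * v i)
  coordinate-isForm i = record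
    { respˡ  = λ z u≈v → cong (_* z i) (u≈v i)
    ; B-comm = λ u v → *-comm (u i) (v i)
    ; homo-+ = λ u v z → distribʳ (z i) (u i) (v i)
    ; homo-· = λ c v z → *-assoc c (v i) (z i)
    ; nonneg = λ v → 0≤x*x (v i)
    }

  zero-isForm : IsForm (λ _ _ → 0#)
  zero-isForm = record
    { respˡ  = λ _ _ → refl
    ; B-comm = λ _ _ → refl
    ; homo-+ = λ _ _ _ → sym (+-identityˡ 0#)
    ; homo-· = λ c _ _ → sym (zeroʳ c)
    ; nonneg = λ _ → IsTotalOrder.refl isTotalOrder
    }

  +-isForm : ∀ {B B′} → IsForm B → IsForm B′ → IsForm (λ u v → B u v + B′ u v)
  +-isForm F F′ = record
    { respˡ  = λ z u≈v → cong₂ _+_ (F.respˡ z u≈v) (F′.respˡ z u≈v)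
    ; B-comm = λ u v → cong₂ _+_ (F.B-comm u v) (F′.B-comm u v)
    ; homo-+ = λ u v z → trans (cong₂ _+_ (F.homo-+ u v z) (F′.homo-+ u v z)) (interchange _ _ _ _)
    ; homo-· = λ c v z → trans (cong₂ _+_ (F.homo-· c v z) (F′.homo-· c v z)) (sym (distribˡ c _ _))
    ; nonneg = λ v → +-nonneg (F.nonneg v) (F′.nonneg v)
    }
    where
    module F  = IsForm F
    module F′ = IsForm F′

  sumF-isForm : ∀ {m} {B : Fin m → V → V → Carrier} → (∀ i → IsForm (B i)) →
    IsForm (λ u v → sumF (λ i → B i u v))
  sumF-isForm {zero}  F = zero-isForm
  sumF-isForm {suc m} F = +-isForm (F zero) (sumF-isForm (F ∘ suc))

  dot-isForm : IsForm dot
  dot-isForm = sumF-isForm coordinate-isForm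

  sumF-nonneg : ∀ {m} {f : Fin m → Carrier} → (∀ i → 0# ≤F f i) → 0# ≤F sumF f
  sumF-nonneg {zero}  _   = IsTotalOrder.refl isTotalOrder
  sumF-nonneg {suc m} 0≤f = +-nonneg (0≤f zero) (sumF-nonneg (0≤f ∘ suc))

  sumF≡0⇒≡0 : ∀ {m} {f : Fin m → Carrier} → (∀ i → 0# ≤F f i) → sumF f ≡ 0# → ∀ i → f i ≡ 0#
  sumF≡0⇒≡0 0≤f Σ≡0 zero    = x+y≡0⇒x≡0 (0≤f zero) (sumF-nonneg (0≤f ∘ suc)) Σ≡0
  sumF≡0⇒≡0 0≤f Σ≡0 (suc i) =
    sumF≡0⇒≡0 (0≤f ∘ suc) (x+y≡0⇒y≡0 (0≤f zero) (sumF-nonneg (0≤f ∘ suc)) Σ≡0) i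

  dot-definite : ∀ v → dot v v ≡ 0# → v ≈V 0V
  dot-definite v vv≡0 i = x*x≡0⇒x≡0 (sumF≡0⇒≡0 (λ j → 0≤x*x (v j)) vv≡0 i)

  dot-zeroʳ : ∀ c {v} → v ≈V 0V → dot c v ≡ 0#
  dot-zeroʳ c {v} v≈0 = begin
    dot c v            ≡⟨ respʳ c (λ i → trans (v≈0 i) (sym (zeroˡ _))) ⟩
    dot c (0# ·V c)    ≡⟨ B-comm c (0# ·V c) ⟩
    dot (0# ·V c) c    ≡⟨ homo-· 0# c c ⟩
    0# * dot c c       ≡⟨ zeroˡ _ ⟩
    0#                 ∎
    where
    open ≡-Reasoning
    open IsForm dot-isForm

  module _ {A : Set} where
    sumL : (A → Carrier) → List A → Carrier
    sumL f xs = foldr _+_ 0# (map f xs)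

    sumL-isForm : {B : A → V → V → Carrier} → (∀ x → IsForm (B x)) → ∀ xs →
      IsForm (λ u v → sumL (λ x → B x u v) xs)
    sumL-isForm F []       = zero-isForm
    sumL-isForm F (x ∷ xs) = +-isForm (F x) (sumL-isForm F xs)

    sumL-nonneg : {f : A → Carrier} → (∀ x → 0# ≤F f x) → ∀ xs → 0# ≤F sumL f xs
    sumL-nonneg 0≤f []       = IsTotalOrder.refl isTotalOrder
    sumL-nonneg 0≤f (x ∷ xs) = +-nonneg (0≤f x) (sumL-nonneg 0≤f xs)

    -- The entry is returned because group elements occur in a list only up to `≈`. Applied to an
    -- entry equal to `ε`, it reduces definiteness of the averaged form to that of `dot`.
    sumL≡0⇒Any≡0 : {f : A → Carrier} {P : A → Set} → (∀ x → 0# ≤F f x) →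
      ∀ {xs} → Any P xs → sumL f xs ≡ 0# → ∃ λ x → P x × f x ≡ 0#
    sumL≡0⇒Any≡0 0≤f {x ∷ xs} (here px)  Σ≡0 = x , px , x+y≡0⇒x≡0 (0≤f x) (sumL-nonneg 0≤f xs) Σ≡0
    sumL≡0⇒Any≡0 0≤f {x ∷ xs} (there p) Σ≡0 =
      sumL≡0⇒Any≡0 0≤f p (x+y≡0⇒y≡0 (0≤f x) (sumL-nonneg 0≤f xs) Σ≡0)

-- The geometric representation and pointwise equality of vectors.

module Representation {K : OrderedField} {n r : ℕ} (G : FiniteReflectionCoxeterSystem K n r) where
  open OrderedField K using (0#; 1#; _+_; _*_; -_) renaming (Carrier to F)
  open OrderedFieldProperties K
  open Vectors K n
  open Forms K n
  open FiniteReflectionCoxeterSystem G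
  open Group W using
    (Carrier; _≈_; _∙_; ε; _⁻¹; inverseˡ; inverseʳ; setoid; assoc; ∙-congˡ; ∙-congʳ; identityʳ)
    renaming (sym to ≈-sym)
  open GroupStuff W
  open IsCoxeterSystem coxeter

  V-setoid : Setoid 0ℓ 0ℓ
  V-setoid = record
    { Carrier = V
    ; _≈_ = _≈V_
    ; isEquivalence = record
      { refl = λ _ → refl ; sym = λ p i → sym (p i) ; trans = λ p q i → trans (p i) (q i) }
    }
  open Setoid V-setoid public using () renaming (sym to V-sym; trans to V-trans)

  ρ-homo-+ : ∀ x u v → ρ x (u +V v) ≈V (ρ x u +V ρ x v)
  ρ-homo-+ x = proj₁ (ρ-linear x)

  ρ-homo-· : ∀ x c v → ρ x (c ·V v) ≈V (c ·V ρ x v)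
  ρ-homo-· x = proj₂ (ρ-linear x)

  ρ-homo-- : ∀ x u v → ρ x (u -V v) ≈V (ρ x u -V ρ x v)
  ρ-homo-- x u v i = trans (ρ-homo-+ x u _ i) (cong (ρ x u i +_) (ρ-homo-· x _ v i))

  -- Linearity does not give this without function extensionality; for a reflection it
  -- holds because a vector that is pointwise zero lies on the hyperplane and is fixed.
  ρ-s-cong : ∀ a {u v} → u ≈V v → ρ (s a) u ≈V ρ (s a) v
  ρ-s-cong a {u} {v} u≈v with _ , _ , c , _ , fix ← reflections a =
    u-v≈0⇒u≈v $ V-trans (V-sym (ρ-homo-- (s a) u v))
      (V-trans (proj₂ (fix (u -V v)) (dot-zeroʳ c (u≈v⇒u-v≈0 u≈v))) (u≈v⇒u-v≈0 u≈v))

  ρ-word-cong : ∀ as {u v} → u ≈V v → ρ (wordProd s as) u ≈V ρ (wordProd s as) v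
  ρ-word-cong [] {u} {v} u≈v = V-trans (ρ-ε u) (V-trans u≈v (V-sym (ρ-ε v)))
  ρ-word-cong (a ∷ as) {u} {v} u≈v = V-trans (ρ-hom (s a) _ u)
    (V-trans (ρ-s-cong a (ρ-word-cong as u≈v)) (V-sym (ρ-hom (s a) _ v)))

  -- Since the simple reflections generate `W`, words in them suffice.
  ρ-cong : ∀ x {u v} → u ≈V v → ρ x u ≈V ρ x v
  ρ-cong x {u} {v} u≈v with as , as≈x ← generates x =
    V-trans (V-sym (ρ-resp as≈x u)) (V-trans (ρ-word-cong as u≈v) (ρ-resp as≈x v))

  ρ-cancel : ∀ {x y} → x ∙ y ≈ ε → ∀ v → ρ x (ρ y v) ≈V v
  ρ-cancel {x} {y} xy≈ε v = V-trans (V-sym (ρ-hom x y v)) (V-trans (ρ-resp xy≈ε v) (ρ-ε v))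

  -- A `W`-invariant positive definite form, by averaging.

  record InvariantForm : Set where
    field
      B         : V → V → F
      isForm    : IsForm B
      definite  : ∀ v → B v v ≡ 0# → v ≈V 0V
      invariant : ∀ x u v → B (ρ x u) (ρ x v) ≡ B u v
    open IsForm isForm public

  -- Averaging must count each group element exactly once, and a duplicate-free enumeration is
  -- available only under double negation.
  ¬¬invariantForm : ¬ ¬ InvariantForm
  ¬¬invariantForm k with xs , complete ← finite = ¬¬unique setoid xs λ { (ys , ys! , xs⊆) →
      k (average ys ys! (λ x → xs⊆ (complete x))) }
    where
    open Membership setoid using (_∈_)
    open Uniqueness setoid using (Unique)

    translated : Carrier → V → V → F
    translated x u v = dot (ρ x u) (ρ x v)

    translated-isForm : ∀ x → IsForm (translated x)
    translated-isForm x = record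
      { respˡ  = λ z u≈v → D.respˡ _ (ρ-cong x u≈v)
      ; B-comm = λ u v → D.B-comm _ _
      ; homo-+ = λ u v z → trans (D.respˡ _ (ρ-homo-+ x u v)) (D.homo-+ _ _ _)
      ; homo-· = λ c v z → trans (D.respˡ _ (ρ-homo-· x c v)) (D.homo-· _ _ _)
      ; nonneg = λ v → D.nonneg _
      }
      where module D = IsForm dot-isForm

    translated-resp : ∀ {x y} → x ≈ y → ∀ u v → translated x u v ≡ translated y u v
    translated-resp x≈y u v = trans (D.respˡ _ (ρ-resp x≈y u)) (D.respʳ _ (ρ-resp x≈y v))
      where module D = IsForm dot-isForm

    average : ∀ ys → Unique ys → (∀ x → x ∈ ys) → InvariantForm
    average ys ys! complete = record
      { B         = B
      ; isForm    = isForm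
      ; definite  = definite
      ; invariant = invariant
      }
      where
      B : V → V → F
      B u v = sumL (λ x → translated x u v) ys

      isForm : IsForm B
      isForm = sumL-isForm translated-isForm ys

      definite : ∀ v → B v v ≡ 0# → v ≈V 0V
      definite v Bvv≡0
        with x , ε≈x , vv≡0 ← sumL≡0⇒Any≡0 (λ x → IsForm.nonneg (translated-isForm x) v)
                                (complete ε) Bvv≡0
        = V-trans (V-sym (V-trans (ρ-resp (≈-sym ε≈x) v) (ρ-ε v))) (dot-definite (ρ x v) vv≡0)

      module _ (x : Carrier) where
        translates! : Unique (map (_∙ x) ys)
        translates! = Uniquenessₚ.map⁺ setoid setoid (λ {a} {b} → Groupₚ.∙-cancelʳ W x a b) ys!

        translates-complete : ∀ z → z ∈ map (_∙ x) ys
        translates-complete z = Membershipₚ.∈-resp-≈ setoid (Groupₚ.//-rightDividesˡ W x z)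
          (Membershipₚ.∈-map⁺ setoid setoid ∙-congʳ (complete (z ∙ x ⁻¹)))

        -- Acting by `x` on both arguments turns the summand at `y` into the summand at `y ∙ x`.
        sum-translates : ∀ u v zs →
          sumL (λ y → translated y (ρ x u) (ρ x v)) zs ≡ sumL (λ z → translated z u v) (map (_∙ x) zs)
        sum-translates u v []       = refl
        sum-translates u v (z ∷ zs) = cong₂ _+_
          (trans (D.respˡ _ (V-sym (ρ-hom z x u))) (D.respʳ _ (V-sym (ρ-hom z x v))))
          (sum-translates u v zs)
          where module D = IsForm dot-isForm

        invariant : ∀ u v → B (ρ x u) (ρ x v) ≡ B u v
        -- Both lists enumerate `W` without repetition, so the two sums differ only in order.
        invariant u v = trans (sum-translates u v ys)
          (Permutationₚ.foldr-commMonoid F-setoid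
            (CommutativeRing.+-isCommutativeMonoid commutativeRing)
            (Permutationₚ.map⁺ setoid F-setoid (λ x≈y → translated-resp x≈y u v)
              (unique-⊆⇒↭ setoid ys! translates! (λ _ → translates-complete _) (λ _ → complete _))))
          where F-setoid = CommutativeRing.setoid commutativeRing

  -- Reflections, their hyperplanes and orthogonality.

  record Reflection (x : Carrier) : Set where
    field
      -- A linear functional whose kernel is the fixed hyperplane.
      root           : V → F
      root-homo-+·   : ∀ u c v → root (u +V (c ·V v)) ≡ root u + c * root v
      fixed⇒root≡0   : ∀ {v} → ρ x v ≈V v → root v ≡ 0#
      root≡0⇒fixed   : ∀ {v} → root v ≡ 0# → ρ x v ≈V v
      involutive     : x ∙ x ≈ ε

  conjugate-involutive : ∀ y a → ((y ∙ s a) ∙ y ⁻¹) ∙ ((y ∙ s a) ∙ y ⁻¹) ≈ ε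
  conjugate-involutive y a = begin
    x ∙ ((y ∙ s a) ∙ y ⁻¹)    ≈⟨ assoc x (y ∙ s a) (y ⁻¹) ⟨
    x ∙ (y ∙ s a) ∙ y ⁻¹      ≈⟨ ∙-congʳ (≈-sym (assoc x y (s a))) ⟩
    x ∙ y ∙ s a ∙ y ⁻¹        ≈⟨ ∙-congʳ (∙-congʳ (Groupₚ.//-rightDividesˡ W y (y ∙ s a))) ⟩
    y ∙ s a ∙ s a ∙ y ⁻¹      ≈⟨ ∙-congʳ (assoc y (s a) (s a)) ⟩
    y ∙ (s a ∙ s a) ∙ y ⁻¹    ≈⟨ ∙-congʳ (∙-congˡ (involution a)) ⟩
    y ∙ ε ∙ y ⁻¹              ≈⟨ ∙-congʳ (identityʳ y) ⟩
    y ∙ y ⁻¹                  ≈⟨ inverseʳ y ⟩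
    ε                         ∎
    where
    open SetoidReasoning setoid
    x = (y ∙ s a) ∙ y ⁻¹

  conjugate-reflection : ∀ y a → Reflection ((y ∙ s a) ∙ y ⁻¹)
  conjugate-reflection y a with _ , _ , c , _ , fix ← reflections a = record
    { root         = λ v → dot c (ρ (y ⁻¹) v)
    ; root-homo-+· = λ u b v → begin
        dot c (ρ (y ⁻¹) (u +V (b ·V v)))                    ≡⟨ D.B-comm c _ ⟩
        dot (ρ (y ⁻¹) (u +V (b ·V v))) c                    ≡⟨ D.respˡ c (ρ-homo-+ _ u _) ⟩
        dot (ρ (y ⁻¹) u +V ρ (y ⁻¹) (b ·V v)) c             ≡⟨ D.homo-+ _ _ c ⟩
        dot (ρ (y ⁻¹) u) c + dot (ρ (y ⁻¹) (b ·V v)) c      ≡⟨ cong₂ _+_ (D.B-comm _ c)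
            (trans (D.respˡ c (ρ-homo-· _ b v)) (trans (D.homo-· b _ c) (cong (b *_) (D.B-comm _ c)))) ⟩
        dot c (ρ (y ⁻¹) u) + b * dot c (ρ (y ⁻¹) v)         ∎
    ; fixed⇒root≡0 = λ {v} xv≈v → proj₁ (fix (ρ (y ⁻¹) v))
        (V-trans (V-sym (ρ-cancel (inverseˡ y) _)) (ρ-cong (y ⁻¹) (V-trans (V-sym (expand v)) xv≈v)))
    ; root≡0⇒fixed = λ {v} root≡0 → V-trans (expand v)
        (V-trans (ρ-cong y (proj₂ (fix (ρ (y ⁻¹) v)) root≡0)) (ρ-cancel (inverseʳ y) v))
    ; involutive   = conjugate-involutive y a
    }
    where
    open ≡-Reasoning
    module D = IsForm dot-isForm
    expand : ∀ v → ρ ((y ∙ s a) ∙ y ⁻¹) v ≈V ρ y (ρ (s a) (ρ (y ⁻¹) v))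
    expand v = V-trans (ρ-hom (y ∙ s a) (y ⁻¹) v) (ρ-hom y (s a) _)

  -- Faithfulness would make the conjugate equal to `ε`, and hence `s a` as well.
  conjugate-nontrivial : ∀ y a → ¬ (∀ v → ρ ((y ∙ s a) ∙ y ⁻¹) v ≈V v)
  conjugate-nontrivial y a fixed = nontrivial a (begin
    s a                    ≈⟨ Groupₚ.\\-leftDividesʳ W y (s a) ⟨
    y ⁻¹ ∙ (y ∙ s a)       ≈⟨ ∙-congˡ (Groupₚ.x∙y⁻¹≈ε⇒x≈y W _ _ (faithful _ ε
                                (λ v → V-trans (fixed v) (V-sym (ρ-ε v))))) ⟩
    y ⁻¹ ∙ y               ≈⟨ inverseˡ y ⟩
    ε                      ∎)
    where open SetoidReasoning setoid

  -- An involution `x` negates `β = v - x v`. If the root vanished on `β`, then `x` would also fix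
  -- it, forcing `β = - β = 0`.
  root-β≢0 : ∀ {x} (R : Reflection x) {v} → ¬ (ρ x v ≈V v) → ¬ Reflection.root R (v -V ρ x v) ≡ 0#
  root-β≢0 {x} R {v} moved root≡0 = moved $ V-sym $ u-v≈0⇒u≈v λ i → x≡-x⇒x≡0 $ begin
    β i                       ≡⟨ root≡0⇒fixed root≡0 i ⟨
    ρ x β i                   ≡⟨ ρ-homo-- x v (ρ x v) i ⟩
    (ρ x v -V ρ x (ρ x v)) i  ≡⟨ -V-entry (ρ x v) (ρ x (ρ x v)) i ⟩
    ρ x v i + - ρ x (ρ x v) i ≡⟨ cong (λ a → ρ x v i + - a) (ρ-cancel involutive v i) ⟩
    ρ x v i + - v i           ≡⟨ ⁻¹-anti-homo-// (v i) (ρ x v i) ⟨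
    - (v i + - ρ x v i)       ≡⟨ cong -_ (-V-entry v (ρ x v) i) ⟨
    - β i                     ∎
    where
    open Reflection R
    open ≡-Reasoning
    β = v -V ρ x v

  module _ (form : InvariantForm) where
    open InvariantForm form

    -- v - x v spans the B-orthogonal complement of the hyperplane fixed by x.
    moved-orthogonal⇒fixed : ∀ {x} → Reflection x → ∀ {v u} →
      ¬ (ρ x v ≈V v) → B v u ≡ B (ρ x v) u → ρ x u ≈V u
    moved-orthogonal⇒fixed {x} R {v} {u} moved Bvu≡Bxvu
      with root-β⁻¹ , inv ← OrderedField.inverse K _ (root-β≢0 R moved) = root≡0⇒fixed root-u≡0
      where
      open Reflection R
      open ≡-Reasoning
      β : V
      β = v -V ρ x v
      -- This scalar makes `u′ = u + c β` the projection of `u` along `β` onto the hyperplane. The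
      -- goal becomes `c = 0`.
      c : F
      c = - (root u * root-β⁻¹)
      u′ : V
      u′ = u +V (c ·V β)

      root-u′≡0 : root u′ ≡ 0#
      root-u′≡0 = begin
        root u′                                    ≡⟨ root-homo-+· u c β ⟩
        root u + - (root u * root-β⁻¹) * root β    ≡⟨ cong (root u +_) (-‿distribˡ-* _ _) ⟨
        root u + - (root u * root-β⁻¹ * root β)    ≡⟨ cong (λ a → root u + - a) (*-assoc _ _ _) ⟩
        root u + - (root u * (root-β⁻¹ * root β))  ≡⟨ cong (λ a → root u + - (root u * a)) (trans (*-comm _ _) inv) ⟩
        root u + - (root u * 1#)                   ≡⟨ cong (λ a → root u + - a) (*-identityʳ _) ⟩
        root u + - root u                          ≡⟨ -‿inverseʳ _ ⟩
        0#                                         ∎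

      Bvz≡Bxvz⇒Bβz≡0 : ∀ z → B v z ≡ B (ρ x v) z → B β z ≡ 0#
      Bvz≡Bxvz⇒Bβz≡0 z eq = begin
        B β z                       ≡⟨ homo-- v _ z ⟩
        B v z + - B (ρ x v) z       ≡⟨ cong (_+ - B (ρ x v) z) eq ⟩
        B (ρ x v) z + - B (ρ x v) z ≡⟨ -‿inverseʳ _ ⟩
        0#                          ∎

      Bββ≢0 : ¬ B β β ≡ 0#
      Bββ≢0 Bββ≡0 = moved (V-sym (u-v≈0⇒u≈v (definite β Bββ≡0)))

      -- `β` is orthogonal to `u` by hypothesis, and to `u′` by invariance because `x` fixes `u′`.
      -- Hence it is orthogonal to their difference `c β`.
      Bββ*c≡0 : B β β * c ≡ 0#
      Bββ*c≡0 = begin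
        B β β * c            ≡⟨ *-comm _ _ ⟩
        c * B β β            ≡⟨ +-identityˡ _ ⟨
        0# + c * B β β       ≡⟨ cong (_+ c * B β β) (Bvz≡Bxvz⇒Bβz≡0 u Bvu≡Bxvu) ⟨
        B β u + c * B β β    ≡⟨ cong₂ _+_ (B-comm β u) (sym (homo-· c β β)) ⟩
        B u β + B (c ·V β) β ≡⟨ homo-+ u _ β ⟨
        B u′ β               ≡⟨ B-comm u′ β ⟩
        B β u′               ≡⟨ Bvz≡Bxvz⇒Bβz≡0 u′ (trans (sym (invariant x v u′))
                                  (respʳ _ (root≡0⇒fixed root-u′≡0))) ⟩
        0#                   ∎

      root-u≡0 : root u ≡ 0#
      root-u≡0 = begin
        root u               ≡⟨ +-identityʳ _ ⟨
        root u + 0#          ≡⟨ cong (root u +_) (zeroˡ (root β)) ⟨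
        root u + 0# * root β ≡⟨ cong (λ a → root u + a * root β) (x≢0∧xy≡0⇒y≡0 Bββ≢0 Bββ*c≡0) ⟨
        root u + c * root β  ≡⟨ root-homo-+· u c β ⟨
        root u′              ≡⟨ root-u′≡0 ⟩
        0#                   ∎

-- Decreasing chains of flats and the products of their labels.

module Chains {K : OrderedField} {n r : ℕ} (G : FiniteReflectionCoxeterSystem K n r)
              (word : List (Fin r)) where
  open Vectors K n
  open Forms K n
  open FiniteReflectionCoxeterSystem G
  open Group W using (Carrier; _≈_; _∙_; ε; assoc; identityʳ; identityˡ)
    renaming (sym to ≈-sym; trans to ≈-trans)
  open Representation G
  open Arrangement G word

  Chain : Set
  Chain = List (Subset k × Fin k)

  t-reflection : ∀ j → Reflection (t j)
  t-reflection j = conjugate-reflection _ (lookup word j)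

  t-nontrivial : ∀ j → ¬ (∀ v → H j v)
  t-nontrivial j = conjugate-nontrivial _ (lookup word j)

  Flat-stable : ∀ A {v} → ¬ ¬ Flat A v → Flat A v
  Flat-stable A ¬¬F j j∈A = ≈V-stable λ ¬Hv → ¬¬F λ F → ¬Hv (F j j∈A)

  -- The intersection of `A` with its label hyperplane lies strictly below `A` as a subspace and
  -- contains `X`. A vector of it outside `X` would put it strictly between the two, against the
  -- covering relation.
  ⋖⇒Flat-∩ : ∀ {A X j} → A ⋖ X → Label A X j → ∀ {v} → Flat A v → H j v → Flat X v
  ⋖⇒Flat-∩ {A} {X} {j} ((A≤X , _) , cover) (j⊇X , j⊉A , _) {v} Av Hv =
    Flat-stable X λ ¬Xv → cover A∩j ((A≤A∩j , λ A∩j≤A → j⊉A λ u Au → A∩j≤A u Au j (x∈p∪q⁺ (inj₂ (x∈⁅x⁆ j))))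
      , (A∩j≤X , λ X≤A∩j → ¬Xv (X≤A∩j v (join Av Hv))))
    where
    A∩j : Subset k
    A∩j = A ∪ ⁅ j ⁆
    join : ∀ {u} → Flat A u → H j u → Flat A∩j u
    join {u} Au Hu i i∈ with x∈p∪q⁻ A ⁅ j ⁆ i∈
    ... | inj₁ i∈A = Au i i∈A
    ... | inj₂ i∈j = subst (λ i → H i u) (sym (x∈⁅y⁆⇒x≡y j i∈j)) Hu
    A≤A∩j : A ≤L A∩j
    A≤A∩j u A∩ju i i∈A = A∩ju i (x∈p∪q⁺ (inj₁ i∈A))
    A∩j≤X : A∩j ≤L X
    A∩j≤X u Xu = join (A≤X u Xu) (j⊇X u Xu)

  -- Chains listed from the last flat down to the first.
  top : Chain → Subset k
  top []            = ∅
  top ((X , _) ∷ _) = X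

  lastLabel : Chain → Maybe (Fin k)
  lastLabel []            = nothing
  lastLabel ((_ , j) ∷ _) = just j

  -- Listing from the end exposes the last flat and label, the data recovered first from the
  -- product. Going down the list, the label indices decrease.
  data RevChain : Chain → Set where
    []   : RevChain []
    cons : ∀ {X j C} → top C ⋖ X → Label (top C) X j →
           (∀ i → lastLabel C ≡ just i → toℕ i < toℕ j) →
           RevChain C → RevChain ((X , j) ∷ C)

  pRev : Chain → Carrier
  pRev []            = ε
  pRev ((_ , j) ∷ C) = pRev C ∙ t j

  ʳ++-revChain : ∀ {C} → RevChain C → ∀ {D} → DecChain (top C) (lastLabel C) D → RevChain (D ʳ++ C)
  ʳ++-revChain R done                  = R
  ʳ++-revChain R (step A⋖X lab inc D) = ʳ++-revChain (cons A⋖X lab inc R) D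

  pRev-ʳ++ : ∀ D C → pRev (D ʳ++ C) ≈ pRev C ∙ p D
  pRev-ʳ++ []            C = ≈-sym (identityʳ _)
  pRev-ʳ++ ((X , j) ∷ D) C = ≈-trans (pRev-ʳ++ D ((X , j) ∷ C)) (assoc _ _ _)

  -- The last flat lies in every label hyperplane of the chain, so each factor fixes it pointwise.
  top-fixed : ∀ {C} → RevChain C → ∀ {v} → Flat (top C) v → ρ (pRev C) v ≈V v
  top-fixed [] {v} _ = ρ-ε v
  top-fixed {(X , j) ∷ C} (cons ((C≤X , _) , _) (j⊇X , _) _ R) {v} Xv =
    V-trans (ρ-hom (pRev C) (t j) v)
      (V-trans (ρ-cong (pRev C) (j⊇X v Xv)) (top-fixed R (C≤X v Xv)))

  -- Carter's lemma.
  fixed⇒top : ∀ {C} → RevChain C → ∀ {v} → ρ (pRev C) v ≈V v → Flat (top C) v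
  fixed⇒top [] _ j j∈∅ = contradiction j∈∅ ∉⊥
  fixed⇒top {(X , j) ∷ C} (cons A⋖X lab@(_ , j⊉A , _) _ R) {v} fixed =
    -- Once `t j` fixes `v`, so does the shorter product, and induction puts `v` in the previous
    -- flat.
    ⋖⇒Flat-∩ A⋖X lab (fixed⇒top R (V-trans (ρ-cong (pRev C) (V-sym v∈Hj)) fixed′)) v∈Hj
    where
    fixed′ : ρ (pRev C) (ρ (t j) v) ≈V v
    fixed′ = V-trans (V-sym (ρ-hom (pRev C) (t j) v)) fixed

    -- Write `q` for `pRev C`. If `t j` moved `v`, each `u` in the previous flat would satisfy `B v
    -- u = B (q (t j v)) (q u) = B (t j v) u`, since `q` fixes `u`. Then `t j` would fix that whole
    -- flat, contradicting the choice of label.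
    v∈Hj : H j v
    v∈Hj = ≈V-stable λ v∉Hj → ¬¬invariantForm λ form →
      let open InvariantForm form in
      j⊉A λ u Au → moved-orthogonal⇒fixed form (t-reflection j) v∉Hj $
        trans (trans (sym (respˡ u fixed′)) (sym (respʳ _ (top-fixed R Au))))
              (invariant (pRev C) (ρ (t j) v) u)

  -- Either `H i` misses part of the previous flat, and maximality of the label bounds `i`, or it
  -- contains that flat, and induction bounds `i` by an earlier, smaller label. The empty chain
  -- cannot arise there, since no `H i` is all of `V`.
  ⊇top⇒≤lastLabel : ∀ {X j C} → RevChain ((X , j) ∷ C) → ∀ {i} → i ⊇H X → toℕ i ≤ toℕ j
  ⊇top⇒≤lastLabel {X} {j} {C} (cons _ (_ , _ , max) inc R) {i} i⊇X =
    decidable-stable (toℕ i ℕₚ.≤? toℕ j) λ i≰j → ¬¬-excluded-middle λ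
      { (yes i⊇A) → i≰j (ℕₚ.<⇒≤ (below R inc i⊇A))
      ; (no i⊉A)  → i≰j (max i i⊇X i⊉A) }
    where
    below : ∀ {C} → RevChain C → (∀ l → lastLabel C ≡ just l → toℕ l < toℕ j) →
      i ⊇H top C → toℕ i < toℕ j
    below [] _ i⊇∅ = contradiction (λ v → i⊇∅ v λ _ l∈∅ → contradiction l∈∅ ∉⊥) (t-nontrivial i)
    below R@(cons _ _ _ _) inc i⊇A = ℕₚ.≤-<-trans (⊇top⇒≤lastLabel R i⊇A) (inc _ refl)

  pRev-≈⇒top-≤ : ∀ {C D} → RevChain C → RevChain D → pRev C ≈ pRev D → top C ≤L top D
  pRev-≈⇒top-≤ R S C≈D v Dv = fixed⇒top R (V-trans (ρ-resp C≈D v) (top-fixed S Dv))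

  -- Otherwise the fixed space would be all of `V`, yet it lies in the proper subspace `H j`.
  ε≉pRev-cons : ∀ {X j C} → RevChain ((X , j) ∷ C) → ¬ ε ≈ pRev ((X , j) ∷ C)
  ε≉pRev-cons {j = j} R@(cons _ (j⊇X , _) _ _) ε≈ =
    t-nontrivial j λ v → j⊇X v (pRev-≈⇒top-≤ R [] (≈-sym ε≈) v λ _ l∈∅ → contradiction l∈∅ ∉⊥)

  pRev-injective : ∀ {C D} → RevChain C → RevChain D → pRev C ≈ pRev D → SameChain C D
  pRev-injective []               []               _  = []
  pRev-injective []               S@(cons _ _ _ _) eq = contradiction eq (ε≉pRev-cons S)
  pRev-injective R@(cons _ _ _ _) []               eq = contradiction (≈-sym eq) (ε≉pRev-cons R)
  pRev-injective {(X , i) ∷ C} {(Y , j) ∷ D} R@(cons _ (i⊇X , _) _ R′) S@(cons _ (j⊇Y , _) _ S′) eq =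
    (X≤Y , Y≤X) ∷ pRev-injective R′ S′ (Groupₚ.∙-cancelʳ W (t j) _ _
      (subst (λ l → pRev C ∙ t l ≈ pRev D ∙ t j) i≡j eq))
    where
    X≤Y : X ≤L Y
    X≤Y = pRev-≈⇒top-≤ R S eq
    Y≤X : Y ≤L X
    Y≤X = pRev-≈⇒top-≤ S R (≈-sym eq)
    -- Both are the largest index of a hyperplane containing the common last flat.
    i≡j : i ≡ j
    i≡j = toℕ-injective (ℕₚ.≤-antisym
      (⊇top⇒≤lastLabel S λ v Yv → i⊇X v (X≤Y v Yv))
      (⊇top⇒≤lastLabel R λ v Xv → j⊇Y v (Y≤X v Xv)))

  φ-injective : ∀ C D → IsDecChain C → IsDecChain D → φ C ≈ φ D → SameChain C D
  φ-injective C D R S φC≈φD =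
    -- Cancel `w` on the right, compare the reversed chains, and reverse back.
    subst₂ SameChain (reverse-involutive C) (reverse-involutive D)
      (Pointwise.reverse⁺ (pRev-injective (ʳ++-revChain [] R) (ʳ++-revChain [] S)
        (≈-trans (pRev-reverse C) (≈-trans (Groupₚ.∙-cancelʳ W w _ _ φC≈φD) (≈-sym (pRev-reverse D))))))
    where
    pRev-reverse : ∀ C → pRev (reverse C) ≈ p C
    pRev-reverse C = ≈-trans (pRev-ʳ++ C []) (identityˡ _)

theorem3p3 : (K : OrderedField) (n r : ℕ) (G : FiniteReflectionCoxeterSystem K n r)
    (word : List (Fin r)) → Arrangement.IsReduced G word →
    (C C' : List (Subset (Arrangement.k G word) × Fin (Arrangement.k G word))) →
    Arrangement.IsDecChain G word C → Arrangement.IsDecChain G word C' →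
    Group._≈_ (FiniteReflectionCoxeterSystem.W G) (Arrangement.φ G word C) (Arrangement.φ G word C') →
    Arrangement.SameChain G word C C'
theorem3p3 K n r G word _ = Chains.φ-injective G word
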